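{- $S_d(5,1)\le 2d$; that is, there is a search algorithm for $5$ robots, at most $1$ of which is byzantine faulty, whose search time for a target at (unknown) distance $d$ from the origin is at most $2d$, for every $d>0$.
   Context: Model. $n$ robots with distinct identities start at time $0$ at the origin of the real line and move along the line with speed at most $1$, changing direction or speed at no cost. A target lies at an unknown point at distance $d>0$ from the origin, i.e. at $d$ or $-d$, with $d$ unknown to the robots. At most $f$ robots are faulty; the bound $f$ is known, but not which robots are faulty. A search algorithm assigns each robot a trajectory, known to all robots; a robot's further motion may depend on the messages broadcast so far (computation and communication take no time). A robot detects whether the target is at a point only by being there. The only messages are announcements "the target is here", heard instantly by all robots at any distance; each message automatically carries the true identity and true current location of its sender. A robot visiting a point silently is taken to claim that the target is not there. Reliable (non-faulty) robots follow the algorithm and report truthfully. Faulty robots are controlled by an adversary: they may stay silent at the target or announce the target where it is not; a faulty robot that broadcasts while off its assigned trajectory is thereby detected as faulty. The search is completed at the first time when some reliable robot has visited the target and announced it and all reliable robots can be certain of its location (every scenario with at most $f$ faulty robots consistent with the messages so far has the target at that location). For an algorithm, the search time $S_d(n,f)$ is the worst-case completion time over both positions $\pm d$ of the target, all choices of at most $f$ faulty robots, and all behaviours of the faulty robots. The inequality $S_d(n,f)\le cd$ means that there is an algorithm, not depending on $d$, with search time at most $cd$ for every $d>0$. -}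

module Defs where

open import Algebra.Structures using (IsCommutativeRing)
open import Data.Bool.Base using (Bool; if_then_else_)
open import Data.Fin.Base using (Fin)
open import Data.Fin.Subset using (Subset; _∈_; _∉_; ∣_∣)
open import Data.Maybe.Base using (Maybe; just; nothing)
import Data.Nat.Base as ℕ
open ℕ using (ℕ)
open import Data.Product.Base using (Σ; ∃; _×_)
open import Data.Sum.Base using (_⊎_)
open import Relation.Binary.PropositionalEquality.Core using (_≡_; _≢_)
open import Relation.Binary.Structures using (IsTotalOrder)
import Relation.Binary.Construct.NonStrictToStrict as NonStrictToStrict

-- The classical axioms of the real numbers, which determine them up to a
-- unique isomorphism.
record CompleteOrderedField : Set₁ where
  infix  8 -_
  infixl 7 _*_
  infixl 6 _+_ _-_
  infix  4 _≤_
  field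
    Carrier           : Set
    _+_ _*_           : Carrier → Carrier → Carrier
    -_                : Carrier → Carrier
    0# 1#             : Carrier
    _≤_               : Carrier → Carrier → Set
    isCommutativeRing : IsCommutativeRing _≡_ _+_ _*_ -_ 0# 1#
    0≢1               : 0# ≢ 1#
    inverse           : ∀ x → x ≢ 0# → ∃ λ y → x * y ≡ 1#
    isTotalOrder      : IsTotalOrder _≡_ _≤_
    +-monoʳ-≤         : ∀ x {y z} → y ≤ z → x + y ≤ x + z
    *-nonNeg          : ∀ {x y} → 0# ≤ x → 0# ≤ y → 0# ≤ x * y

  _-_ : Carrier → Carrier → Carrier
  x - y = x + (- y)

  open NonStrictToStrict _≡_ _≤_ public using (_<_)

  UpperBound : (Carrier → Set) → Carrier → Set
  UpperBound S b = ∀ x → S x → x ≤ b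

  field
    supremum : (S : Carrier → Set) → ∃ S → ∃ (UpperBound S) →
               ∃ λ s → UpperBound S s × (∀ b → UpperBound S b → s ≤ b)

  2# : Carrier
  2# = 1# + 1#

module Search (R : CompleteOrderedField) where

  open CompleteOrderedField R renaming (Carrier to ℝ)

  -- Times are elements of ℝ; only the values at times t with 0# ≤ t matter,
  -- for trajectories as well as for logs.
  record IsTrajectory (x : ℝ → ℝ) : Set where
    field
      start : x 0# ≡ 0#
      speed : ∀ s t → 0# ≤ s → s ≤ t →
              (x t - x s ≤ t - s) × (x s - x t ≤ t - s)

  -- log i t ≡ just p : at time t, robot i announces the target, and the
  -- location attached to its message is p.
  -- log i t ≡ nothing : robot i is silent at time t.
  Log : ℕ → Set
  Log n = Fin n → ℝ → Maybe ℝ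

  AgreeBefore : ∀ {n} → ℝ → Log n → Log n → Set
  AgreeBefore t log log′ = ∀ i s → 0# ≤ s → s < t → log i s ≡ log′ i s

  -- Everything the algorithm does not control.  The path and the announcements
  -- of robot i are only used when i is faulty.  An adversary that reacts to
  -- what it hears is covered because all scenarios are considered.
  record Scenario (n f : ℕ) : Set where
    field
      target       : ℝ
      target≢0     : target ≢ 0#
      faulty       : Subset n
      ∣faulty∣≤f   : ∣ faulty ∣ ℕ.≤ f
      path         : Fin n → ℝ → ℝ
      isTrajectory : ∀ i → IsTrajectory (path i)
      announces    : Fin n → ℝ → Bool

  -- The trajectories assigned to the robots, given the messages.
  Motion : ℕ → Set
  Motion n = Log n → Fin n → ℝ → ℝ

  module _ {n f : ℕ} (position : Motion n) where

    open Scenario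

    -- The messages at time t are those sent in scenario σ.  A reliable robot
    -- announces exactly when it is at the target; the location attached to a
    -- message of a faulty robot is its true one.
    record MessagesAt (σ : Scenario n f) (log : Log n) (t : ℝ) : Set where
      field
        reliable-at-target  : ∀ i → i ∉ faulty σ → position log i t ≡ target σ →
                              log i t ≡ just (position log i t)
        reliable-off-target : ∀ i → i ∉ faulty σ → position log i t ≢ target σ →
                              log i t ≡ nothing
        byzantine           : ∀ i → i ∈ faulty σ →
                              log i t ≡ (if announces σ i t
                                         then just (path σ i t) else nothing)

    Execution : Scenario n f → Log n → Set
    Execution σ log = ∀ t → 0# ≤ t → MessagesAt σ log t

    ConsistentUpTo : ℝ → Scenario n f → Log n → Set
    ConsistentUpTo t σ log = ∀ s → 0# ≤ s → s ≤ t → MessagesAt σ log s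

    CertainAt : ℝ → Log n → ℝ → Set
    CertainAt t log y = ∀ σ → ConsistentUpTo t σ log → target σ ≡ y

    FoundBy : ℝ → Scenario n f → Log n → Set
    FoundBy t σ log = ∃ λ i → i ∉ faulty σ × ∃ λ s → 0# ≤ s × s ≤ t ×
                      position log i s ≡ target σ × log i s ≡ just (target σ)

    -- Upward closed in t, so that the completion time of an execution is the
    -- infimum of the t for which this holds.
    CompletedAt : ℝ → Scenario n f → Log n → Set
    CompletedAt t σ log = FoundBy t σ log × CertainAt t log (target σ)

  -- 'causal' makes the motion depend on past messages only.  It does not by
  -- itself guarantee that motion and messages can be solved for simultaneously
  -- (time is not well-ordered), and without 'executable' an algorithm lacking
  -- executions would have every search time bound vacuously.
  record Algorithm (n f : ℕ) : Set where
    field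
      position     : Motion n
      isTrajectory : ∀ log i → IsTrajectory (position log i)
      causal       : ∀ log log′ t → 0# ≤ t → AgreeBefore t log log′ →
                     ∀ i → position log i t ≡ position log′ i t
      executable   : ∀ (σ : Scenario n f) → ∃ (Execution position σ)

  SearchTimeAtMost : ∀ {n f} → Algorithm n f → (d T : ℝ) → Set
  SearchTimeAtMost {n} {f} A d T =
    ∀ (σ : Scenario n f) → target σ ≡ d ⊎ target σ ≡ - d →
    ∀ log → Execution position σ log →
    ∃ λ t → t ≤ T × CompletedAt {f = f} position t σ log
    where
    open Algorithm A using (position)
    open Scenario using (target)

  -- S_d(n, f) ≤ c d
  S[_,_]≤_·d : (n f : ℕ) → ℝ → Set
  S[ n , f ]≤ c ·d =
    Σ (Algorithm n f) λ A → ∀ d → 0# < d → SearchTimeAtMost A d (c * d)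

{-# OPTIONS --safe #-}
-- Two robots walk left, two walk right, all at unit speed, and a scout waits at
-- the origin until the first announcement made by a walker at its assigned
-- place; it then goes to that place.  Let the target be at distance d and let
-- a, b be the walkers on its side.  If both announce it, everybody is certain
-- at time d.  Otherwise one of them, say b, is faulty, so that all other robots
-- are reliable, and there are three cases.
--   * b made no announcement before d: the scout is sent to the target, reaches
--     it at time 2d and confirms it.
--   * b made two announcements before d: they contradict each other.
--   * b made a single announcement, at time s < d: the scout is sent there, and
--     its silence at time 2s < 2d refutes b.
module Submission where

open import Defs
open import Level using (0ℓ)
open import Axiom.ExcludedMiddle using (ExcludedMiddle)
open import Algebra.Bundles using (CommutativeRing)
import Algebra.Properties.AbelianGroup as AbelianGroupProperties
import Algebra.Construct.NaturalChoice.Max as Max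
import Algebra.Construct.NaturalChoice.Min as Min
open import Algebra.Structures using (IsCommutativeRing)
open import Data.Bool.Base using (Bool; true; false; if_then_else_)
open import Data.Empty using (⊥; ⊥-elim)
open import Data.Fin.Base using (Fin; zero; suc)
import Data.Fin.Properties as Fin
open import Data.Fin.Subset using (Subset; _∈_; _∉_; ∣_∣)
open import Data.Fin.Subset.Properties using (_∈?_; x∈p∧x≢y⇒x∈p-y; x∈p⇒∣p-x∣<∣p∣)
open import Data.Maybe.Base using (Maybe; just; nothing)
import Data.Nat.Base as ℕ
import Data.Nat.Properties as ℕ
open import Data.Product.Base using (∃; ∃₂; _×_; _,_; proj₁)
open import Data.Sum.Base using (inj₁; inj₂)
open import Function.Base using (_∘_; id)
open import Relation.Binary.Bundles using (TotalOrder)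
open import Relation.Binary.PropositionalEquality
open import Relation.Binary.Structures using (IsTotalOrder)
open import Relation.Nullary using (¬_; Dec; yes; no; contradiction)
open import Relation.Nullary.Decidable using (decidable-stable)

-- Removing `i` and then `j` would lower the cardinality twice, which a set with at most one element
-- does not allow.
∣p∣≤1⇒unique : ∀ {n} {p : Subset n} {i j} → ∣ p ∣ ℕ.≤ 1 → i ∈ p → i ≢ j → j ∉ p
∣p∣≤1⇒unique {p = p} ∣p∣≤1 i∈p i≢j j∈p = ℕ.n≮0
  (ℕ.<-≤-trans (x∈p⇒∣p-x∣<∣p∣ (x∈p∧x≢y⇒x∈p-y j∈p (i≢j ∘ sym)))
               (ℕ.≤-pred (ℕ.≤-trans (x∈p⇒∣p-x∣<∣p∣ i∈p) ∣p∣≤1)))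

module OrderedField (R : CompleteOrderedField) where

  open CompleteOrderedField R renaming (Carrier to ℝ)
  open IsCommutativeRing isCommutativeRing public
    using (+-assoc; +-comm; +-identityˡ; +-identityʳ; -‿inverseʳ; distribʳ; *-identityˡ)
  open IsTotalOrder isTotalOrder public using (total; antisym)
    renaming (refl to ≤-refl; trans to ≤-trans; reflexive to ≤-reflexive)

  commutativeRing : CommutativeRing 0ℓ 0ℓ
  commutativeRing = record { isCommutativeRing = isCommutativeRing }

  totalOrder : TotalOrder 0ℓ 0ℓ 0ℓ
  totalOrder = record { isTotalOrder = isTotalOrder }

  open AbelianGroupProperties (CommutativeRing.+-abelianGroup commutativeRing) public
    using ()
    renaming ( ⁻¹-involutive to -‿involutive; ⁻¹-injective to -‿injective
             ; ε⁻¹≈ε to -0≡0; //-rightDividesˡ to x-y+y≡x; //-rightDividesʳ to x+y-y≡x)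
  open Max totalOrder public using (_⊔_; x≤y⊔x; x≤x⊔y; ⊔-lub; x≤y⇒x⊔y≈y; x≤y⇒y⊔x≈y)
  open Min totalOrder public using (_⊓_; x⊓y≤x; x⊓y≤y; ⊓-sel; x≤y⇒x⊓y≈x)

  -- Inequalities in an ordered field.

  +-monoˡ-≤ : ∀ z {x y} → x ≤ y → x + z ≤ y + z
  +-monoˡ-≤ z {x} {y} x≤y = subst₂ _≤_ (+-comm z x) (+-comm z y) (+-monoʳ-≤ z x≤y)

  +-mono-≤ : ∀ {x y u v} → x ≤ y → u ≤ v → x + u ≤ y + v
  +-mono-≤ {y = y} {u = u} x≤y u≤v = ≤-trans (+-monoˡ-≤ u x≤y) (+-monoʳ-≤ y u≤v)

  x≤y+x : ∀ {x y} → 0# ≤ y → x ≤ y + x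
  x≤y+x {x} {y} 0≤y = subst (_≤ y + x) (+-identityˡ x) (+-monoˡ-≤ x 0≤y)

  x-y≤z⇒x≤z+y : ∀ {x y z} → x - y ≤ z → x ≤ z + y
  x-y≤z⇒x≤z+y {x} {y} {z} p = subst (_≤ z + y) (x-y+y≡x y x) (+-monoˡ-≤ y p)

  x≤z+y⇒x-y≤z : ∀ {x y z} → x ≤ z + y → x - y ≤ z
  x≤z+y⇒x-y≤z {x} {y} {z} p = subst (x - y ≤_) (x+y-y≡x y z) (+-monoˡ-≤ (- y) p)

  x≤y⇒0≤y-x : ∀ {x y} → x ≤ y → 0# ≤ y - x
  x≤y⇒0≤y-x {x} {y} x≤y = subst (_≤ y - x) (-‿inverseʳ x) (+-monoˡ-≤ (- x) x≤y)

  x≤y⇒x-y≤0 : ∀ {x y} → x ≤ y → x - y ≤ 0#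
  x≤y⇒x-y≤0 {x} {y} x≤y = subst (x - y ≤_) (-‿inverseʳ y) (+-monoˡ-≤ (- y) x≤y)

  2*x≡x+x : ∀ x → 2# * x ≡ x + x
  2*x≡x+x x = trans (distribʳ x 1# 1#) (cong₂ _+_ (*-identityˡ x) (*-identityˡ x))

  -- Lipschitz continuity with constant 1, without absolute values: the hypotheses bound the
  -- distance of `x` and `y`, and exchanging them gives the other half of the conclusion.
  NonExpansive : (ℝ → ℝ) → Set
  NonExpansive h = ∀ {x y e} → 0# ≤ e → x - y ≤ e → y - x ≤ e → h x - h y ≤ e

  nonExpansive-∘ : ∀ {h k} → NonExpansive h → NonExpansive k → NonExpansive (h ∘ k)
  nonExpansive-∘ h k 0≤e p q = h 0≤e (k 0≤e p q) (k 0≤e q p)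

  nonExpansive-neg : NonExpansive (λ x → - x)
  nonExpansive-neg {x} {y} {e} _ _ y-x≤e = subst (_≤ e)
    (trans (+-comm y (- x)) (cong (- x +_) (sym (-‿involutive y)))) y-x≤e

  nonExpansive-⊔ : ∀ c → NonExpansive (_⊔ c)
  nonExpansive-⊔ c {x} {y} {e} 0≤e p _ = x≤z+y⇒x-y≤z (⊔-lub
    (≤-trans (x-y≤z⇒x≤z+y p) (+-monoʳ-≤ e (x≤x⊔y y c)))
    (≤-trans (x≤y+x 0≤e) (+-monoʳ-≤ e (x≤y⊔x y c))))

  nonExpansive-⊓ : ∀ c → NonExpansive (_⊓ c)
  nonExpansive-⊓ c {x} {y} {e} 0≤e p _ = x≤z+y⇒x-y≤z bound
    where
    bound : x ⊓ c ≤ e + (y ⊓ c)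
    bound with ⊓-sel y c
    ... | inj₁ eq = subst (λ z → x ⊓ c ≤ e + z) (sym eq)
                      (≤-trans (x⊓y≤x x c) (x-y≤z⇒x≤z+y p))
    ... | inj₂ eq = subst (λ z → x ⊓ c ≤ e + z) (sym eq)
                      (≤-trans (x⊓y≤y x c) (x≤y+x 0≤e))

  nonExpansive-shift : ∀ c → NonExpansive (λ x → x - c)
  nonExpansive-shift c {x} {y} {e} _ p _ = x≤z+y⇒x-y≤z
    (subst (x - c ≤_) (+-assoc e y (- c)) (+-monoˡ-≤ (- c) (x-y≤z⇒x≤z+y p)))

  nonExpansive⇒trajectory : ∀ {h} → NonExpansive h → h 0# ≡ 0# → Search.IsTrajectory R h
  nonExpansive⇒trajectory h-short h0≡0 = record
    { start = h0≡0
    ; speed = λ s t _ s≤t →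
        let 0≤t-s   = x≤y⇒0≤y-x s≤t
            s-t≤t-s = ≤-trans (x≤y⇒x-y≤0 s≤t) 0≤t-s
        in h-short 0≤t-s ≤-refl s-t≤t-s , h-short 0≤t-s s-t≤t-s ≤-refl
    }

  -- Rays from the origin and delayed walks along them.

  leg : Bool → ℝ → ℝ
  leg true  t = t
  leg false t = - t

  leg-nonExpansive : ∀ b → NonExpansive (leg b)
  leg-nonExpansive true  _ p _ = p
  leg-nonExpansive false = nonExpansive-neg

  leg-0 : ∀ b → leg b 0# ≡ 0#
  leg-0 true  = refl
  leg-0 false = -0≡0

  leg-injective : ∀ b {s t} → leg b s ≡ leg b t → s ≡ t
  leg-injective true  = id
  leg-injective false = -‿injective

  0≤s∧0<t⇒s≢-t : ∀ {s t} → 0# ≤ s → 0# < t → s ≢ - t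
  0≤s∧0<t⇒s≢-t {t = t} 0≤s (0≤t , 0≢t) refl =
    0≢t (antisym 0≤t (subst (t ≤_) (-‿inverseʳ t)
      (subst (_≤ t - t) (+-identityʳ t) (+-monoʳ-≤ t 0≤s))))

  -- The two rays meet only at the origin, which `0# < t` excludes.
  leg-injective₂ : ∀ b c {s t} → 0# ≤ s → 0# < t → leg b s ≡ leg c t → s ≡ t × b ≡ c
  leg-injective₂ true  true  _ _ eq = eq , refl
  leg-injective₂ false false _ _ eq = -‿injective eq , refl
  leg-injective₂ true  false 0≤s 0<t eq = ⊥-elim (0≤s∧0<t⇒s≢-t 0≤s 0<t eq)
  leg-injective₂ false true {s} 0≤s 0<t eq = ⊥-elim
    (0≤s∧0<t⇒s≢-t 0≤s 0<t (trans (sym (-‿involutive s)) (cong (λ z → - z) eq)))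

  -- The distance covered at time t by a robot that waits until time x and then
  -- goes to distance x: it is min(max(t - x, 0), x).
  delayed : ℝ → ℝ → ℝ
  delayed x t = ((t ⊓ (x + x)) ⊔ x) - x

  delayed-nonExpansive : ∀ x → NonExpansive (delayed x)
  delayed-nonExpansive x = nonExpansive-∘ (nonExpansive-shift x)
    (nonExpansive-∘ (nonExpansive-⊔ x) (nonExpansive-⊓ (x + x)))

  delayed-waits : ∀ {x t} → t ≤ x → delayed x t ≡ 0#
  delayed-waits {x} {t} t≤x = trans
    (cong (λ z → z - x) (x≤y⇒x⊔y≈y (≤-trans (x⊓y≤x t (x + x)) t≤x))) (-‿inverseʳ x)

  delayed-arrives : ∀ {x} → 0# ≤ x → delayed x (x + x) ≡ x
  delayed-arrives {x} 0≤x = trans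
    (cong (λ z → z - x) (trans (cong (_⊔ x) (x≤y⇒x⊓y≈x ≤-refl)) (x≤y⇒y⊔x≈y (x≤y+x 0≤x))))
    (x+y-y≡x x x)

module SearchByFive (em : ExcludedMiddle 0ℓ) (R : CompleteOrderedField) where

  open CompleteOrderedField R renaming (Carrier to ℝ)
  open OrderedField R
  open Search R

  ≮⇒≥ : ∀ {x y} → ¬ (x < y) → y ≤ x
  ≮⇒≥ {x} {y} x≮y with total y x
  ... | inj₁ y≤x = y≤x
  ... | inj₂ x≤y = ≤-reflexive (sym (decidable-stable em λ x≢y → x≮y (x≤y , x≢y)))

  -- The motion of the scout and its causality.

  side : Fin 4 → Bool
  side zero                   = false
  side (suc zero)             = false
  side (suc (suc zero))       = true
  side (suc (suc (suc zero))) = true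

  -- An announcement sent from elsewhere exposes its sender as faulty and is disregarded.
  Calls : Log 4 → Fin 4 → ℝ → Set
  Calls m j t = m j t ≡ just (leg (side j) t)

  -- The last condition makes (side j, x) unique; simultaneous first calls from
  -- both sides, which can only happen when a single call settles the matter,
  -- leave the scout without a leader.
  Leads : Log 4 → Fin 4 → ℝ → Set
  Leads m j x = 0# ≤ x × Calls m j x ×
    (∀ k s → 0# ≤ s → s ≤ x → Calls m k s → s ≡ x × side k ≡ side j)

  -- The earlier of the two calls lies in the time span over which the later one must be first, so
  -- the two coincide in time and side.
  Leads-unique : ∀ m {j k x y} → Leads m j x → Leads m k y → x ≡ y × side j ≡ side k
  Leads-unique m {x = x} {y} (0≤x , jx , first-j) (0≤y , ky , first-k) with total x y
  ... | inj₁ x≤y = first-k _ x 0≤x x≤y jx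
  ... | inj₂ y≤x = let y≡x , k≡j = first-j _ y 0≤y y≤x ky in sym y≡x , sym k≡j

  Led : Log 4 → Set
  Led m = ∃₂ λ j x → Leads m j x

  follow : ∀ {m} → Dec (Led m) → ℝ → ℝ
  follow (yes (j , x , _)) t = leg (side j) (delayed x t)
  follow (no _)            t = 0#

  scout : Log 4 → ℝ → ℝ
  scout m = follow {m} em

  scout-isTrajectory : ∀ m → IsTrajectory (scout m)
  scout-isTrajectory m with em {Led m}
  ... | yes (j , x , 0≤x , _) = nonExpansive⇒trajectory
    (nonExpansive-∘ (leg-nonExpansive (side j)) (delayed-nonExpansive x))
    (trans (cong (leg (side j)) (delayed-waits 0≤x)) (leg-0 (side j)))
  ... | no _ = nonExpansive⇒trajectory
    (λ {_} {_} {e} 0≤e _ _ → subst (_≤ e) (sym (-‿inverseʳ 0#)) 0≤e) refl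

  -- Excluded middle provides some leading call, perhaps not the given one; by `Leads-unique` both
  -- prescribe the same path.
  scout-follows : ∀ m {j x} t → Leads m j x → scout m t ≡ leg (side j) (delayed x t)
  scout-follows m t lead with em {Led m}
  ... | no ¬led = contradiction (_ , _ , lead) ¬led
  ... | yes (_ , _ , lead′) =
    let x′≡x , k≡j = Leads-unique m lead′ lead in
    cong₂ (λ b y → leg b (delayed y t)) k≡j x′≡x

  scout-waits : ∀ m {t} → (∀ j x → Leads m j x → ¬ (x < t)) → scout m t ≡ 0#
  scout-waits m unled with em {Led m}
  ... | no _ = refl
  ... | yes (j , x , lead) =
    trans (cong (leg (side j)) (delayed-waits (≮⇒≥ (unled j x lead)))) (leg-0 (side j))

  scout-arrives : ∀ m {j x} → Leads m j x → scout m (x + x) ≡ leg (side j) x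
  scout-arrives m {j} {x} lead@(0≤x , _) =
    trans (scout-follows m (x + x) lead) (cong (leg (side j)) (delayed-arrives 0≤x))

  ≤-<-trans : ∀ {x y z} → x ≤ y → y < z → x < z
  ≤-<-trans x≤y (y≤z , y≢z) =
    ≤-trans x≤y y≤z , λ { refl → y≢z (antisym y≤z x≤y) }

  -- Leading at time `x` depends on the log up to time `x` only.
  Leads-resp-AgreeBefore : ∀ {m m′ t j x} → AgreeBefore t m m′ → x < t →
                           Leads m j x → Leads m′ j x
  Leads-resp-AgreeBefore {j = j} {x} agree x<t (0≤x , jx , first) =
    0≤x , trans (sym (agree j x 0≤x x<t)) jx ,
    λ k s 0≤s s≤x ks → first k s 0≤s s≤x (trans (agree k s 0≤s (≤-<-trans s≤x x<t)) ks)

  -- The scout is defined from the whole log, future included, but a leading call at `x` moves it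
  -- only after `x`. A leading call before `t` is common to both logs; if there is none, the scout
  -- is at the origin at time `t` under both.
  scout-causal : ∀ m m′ t → AgreeBefore t m m′ → scout m t ≡ scout m′ t
  scout-causal m m′ t agree with em {∃₂ λ j x → Leads m j x × x < t}
  ... | yes (j , x , lead , x<t) = trans (scout-follows m t lead)
    (sym (scout-follows m′ t (Leads-resp-AgreeBefore agree x<t lead)))
  ... | no unled = trans
    (scout-waits m λ j x lead x<t → unled (j , x , lead , x<t))
    (sym (scout-waits m′ λ j x lead′ x<t → unled
      (j , x , Leads-resp-AgreeBefore (λ i s p q → sym (agree i s p q)) x<t lead′ , x<t)))

  walkers : Log 5 → Log 4
  walkers log j = log (suc j)

  position : Motion 5
  position log zero    = scout (walkers log)
  position log (suc j) = leg (side j)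

  position-isTrajectory : ∀ log i → IsTrajectory (position log i)
  position-isTrajectory log zero    = scout-isTrajectory (walkers log)
  position-isTrajectory log (suc j) =
    nonExpansive⇒trajectory (leg-nonExpansive (side j)) (leg-0 (side j))

  position-causal : ∀ log log′ t → 0# ≤ t → AgreeBefore t log log′ →
                    ∀ i → position log i t ≡ position log′ i t
  position-causal log log′ t _ agree zero =
    scout-causal (walkers log) (walkers log′) t (λ j → agree (suc j))
  position-causal log log′ t _ agree (suc j) = refl

  -- Existence of executions.

  open Scenario

  module _ (σ : Scenario 5 1) where

    -- With the place `p` as a parameter, reports do not refer to a log, so a log can be built from
    -- them.
    report : Fin 5 → ℝ → ℝ → Maybe ℝ
    report i t p with i ∈? faulty σ | em {p ≡ target σ}
    ... | yes _ | _     = if announces σ i t then just (path σ i t) else nothing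
    ... | no _  | yes _ = just p
    ... | no _  | no _  = nothing

    report-at-target : ∀ i t p → i ∉ faulty σ → p ≡ target σ → report i t p ≡ just p
    report-at-target i t p i∉ p≡ with i ∈? faulty σ | em {p ≡ target σ}
    ... | yes i∈ | _     = contradiction i∈ i∉
    ... | no _   | yes _ = refl
    ... | no _   | no p≢ = contradiction p≡ p≢

    report-off-target : ∀ i t p → i ∉ faulty σ → p ≢ target σ → report i t p ≡ nothing
    report-off-target i t p i∉ p≢ with i ∈? faulty σ | em {p ≡ target σ}
    ... | yes i∈ | _      = contradiction i∈ i∉
    ... | no _   | yes p≡ = contradiction p≡ p≢
    ... | no _   | no _   = refl

    report-byzantine : ∀ i t p → i ∈ faulty σ →
                       report i t p ≡ (if announces σ i t then just (path σ i t) else nothing)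
    report-byzantine i t p i∈ with i ∈? faulty σ
    ... | yes _ = refl
    ... | no i∉ = contradiction i∈ i∉

    -- The walkers ignore the log, and the scout listens to the walkers only.
    log-of-reports : Log 5
    log-of-reports (suc j) t = report (suc j) t (leg (side j) t)
    log-of-reports zero    t =
      report zero t (scout (λ j t → report (suc j) t (leg (side j) t)) t)

    log-reports : ∀ i t → log-of-reports i t ≡ report i t (position log-of-reports i t)
    log-reports zero    t = refl
    log-reports (suc j) t = refl

    execution : ∃ (Execution {f = 1} position σ)
    execution = log-of-reports , λ t _ → record
      { reliable-at-target  = λ i i∉ at →
          trans (log-reports i t) (report-at-target i t _ i∉ at)
      ; reliable-off-target = λ i i∉ off →
          trans (log-reports i t) (report-off-target i t _ i∉ off)
      ; byzantine           = λ i i∈ →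
          trans (log-reports i t) (report-byzantine i t _ i∈)
      }

  algorithm : Algorithm 5 1
  algorithm = record
    { position     = position
    ; isTrajectory = position-isTrajectory
    ; causal       = position-causal
    ; executable   = execution
    }

  -- What messages reveal about the target.

  module _ {σ : Scenario 5 1} {log : Log 5} {t : ℝ}
           (messages : MessagesAt position σ log t) where

    open MessagesAt messages

    reliable-truthful : ∀ {i p} → i ∉ faulty σ → log i t ≡ just p →
                        position log i t ≡ target σ
    reliable-truthful {i} i∉ said = decidable-stable em λ off →
      contradiction (trans (sym said) (reliable-off-target i i∉ off)) λ ()

    reliable-announces : ∀ {i} → i ∉ faulty σ → position log i t ≡ target σ →
                         log i t ≡ just (target σ)
    reliable-announces {i} i∉ at = trans (reliable-at-target i i∉ at) (cong just at)

  other-reliable : ∀ (σ : Scenario 5 1) {i j} → i ∈ faulty σ → i ≢ j → j ∉ faulty σ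
  other-reliable σ = ∣p∣≤1⇒unique (∣faulty∣≤f σ)

  AnnouncedBy : ℝ → Log 5 → Fin 5 → ℝ → Set
  AnnouncedBy t log i y = ∃ λ s → 0# ≤ s × s ≤ t ×
                          position log i s ≡ y × log i s ≡ just y

  announced-reliably : ∀ {t log i y} σ → ConsistentUpTo position t σ log → i ∉ faulty σ →
                       AnnouncedBy t log i y → target σ ≡ y
  announced-reliably σ consistent i∉ (s , 0≤s , s≤t , at , said) =
    trans (sym (reliable-truthful (consistent s 0≤s s≤t) i∉ said)) at

  -- No consistent scenario can have both announcers faulty.
  certain-of-two : ∀ {t log i j y} → i ≢ j → AnnouncedBy t log i y → AnnouncedBy t log j y →
                   CertainAt {f = 1} position t log y
  certain-of-two {i = i} i≢j by-i by-j σ consistent with i ∈? faulty σ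
  ... | no i∉  = announced-reliably σ consistent i∉ by-i
  ... | yes i∈ = announced-reliably σ consistent (other-reliable σ i∈ i≢j) by-j

  -- a and b are the walkers that pass the target, a being reliable.
  module _ (σ : Scenario 5 1) {d} (0<d : 0# < d) {log} (exec : Execution position σ log)
           {a b} (a≢b : a ≢ b) (a∉ : suc a ∉ faulty σ) (a∥b : side a ≡ side b)
           (target≡ : target σ ≡ leg (side a) d) where

    private
      y = target σ
      m = walkers log

      0≤d : 0# ≤ d
      0≤d = proj₁ 0<d

      d≤d+d : d ≤ d + d
      d≤d+d = x≤y+x 0≤d

      b-at-y : leg (side b) d ≡ y
      b-at-y = trans (cong (λ c → leg c d) (sym a∥b)) (sym target≡)

      a-announces : log (suc a) d ≡ just y
      a-announces = reliable-announces (exec d 0≤d) a∉ (sym target≡)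

      announced-a : ∀ {t} → d ≤ t → AnnouncedBy t log (suc a) y
      announced-a d≤t = d , 0≤d , d≤t , sym target≡ , a-announces

      Completed : ℝ → Set
      Completed t = CompletedAt {f = 1} position t σ log

      found : ∀ {t} → d ≤ t → FoundBy {f = 1} position t σ log
      found d≤t = suc a , a∉ , announced-a d≤t

      -- Completion, according to the calls of `b`.

      completed-if-both : Calls m b d → Completed d
      completed-if-both bd = found ≤-refl ,
        certain-of-two (a≢b ∘ Fin.suc-injective) (announced-a ≤-refl)
          (d , 0≤d , ≤-refl , b-at-y , trans bd (cong just b-at-y))

      call⇒truthful : ∀ (τ : Scenario 5 1) {t k s} → ConsistentUpTo position t τ log →
                      suc k ∉ faulty τ → 0# ≤ s → s ≤ t → Calls m k s →
                      leg (side k) s ≡ target τ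
      call⇒truthful τ consistent k∉ 0≤s s≤t = reliable-truthful (consistent _ 0≤s s≤t) k∉

      -- Scenarios that trust `a` have the target at `y`. In any other, `a` is the one faulty robot,
      -- so `b` and the scout are reliable; `absurd` has to refute this.
      certain-without-b : ∀ {t} → d ≤ t →
        (∀ τ → ConsistentUpTo position t τ log → (∀ i → suc a ≢ i → i ∉ faulty τ) → ⊥) →
        Completed t
      certain-without-b d≤t absurd = found d≤t , certain
        where
        certain : CertainAt position _ log y
        certain τ consistent with suc a ∈? faulty τ
        ... | no a∉τ = announced-reliably τ consistent a∉τ (announced-a d≤t)
        ... | yes a∈τ = ⊥-elim (absurd τ consistent λ i → other-reliable τ a∈τ)

      -- Time `d` itself is allowed; where it matters, `b-silent` excludes it.
      b-called-before : ℝ → Set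
      b-called-before s = 0# ≤ s × s ≤ d × Calls m b s

      -- A reliable walker passes the target only once, so no consistent scenario trusts `b`.
      completed-if-two-calls : ∀ {s t} → s ≢ t → b-called-before s → b-called-before t →
                               Completed d
      completed-if-two-calls s≢t (0≤s , s≤d , bs) (0≤t , t≤d , bt) =
        certain-without-b ≤-refl λ τ consistent reliable →
          let b∉ = reliable (suc b) (a≢b ∘ Fin.suc-injective) in
          s≢t (leg-injective (side b)
            (trans (call⇒truthful τ consistent b∉ 0≤s s≤d bs)
                   (sym (call⇒truthful τ consistent b∉ 0≤t t≤d bt))))

      module _ (b-silent : ¬ Calls m b d) where

        -- A reliable `b` would call at time `d`, being at the target then.
        b∈ : suc b ∈ faulty σ
        b∈ = decidable-stable (suc b ∈? faulty σ) λ b∉ → b-silent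
          (trans (reliable-announces (exec d 0≤d) b∉ b-at-y) (cong just (sym b-at-y)))

        scout∉ : zero ∉ faulty σ
        scout∉ = other-reliable σ b∈ λ ()

        -- Walkers other than `b` are reliable and call only at the target. This serves to show that
        -- the call sending out the scout is the first one.
        call-by-other : ∀ k s → k ≢ b → 0# ≤ s → Calls m k s → s ≡ d × side k ≡ side a
        call-by-other k s k≢b 0≤s ks = leg-injective₂ (side k) (side a) 0≤s 0<d
          (trans (reliable-truthful (exec s 0≤s)
                    (other-reliable σ b∈ (k≢b ∘ sym ∘ Fin.suc-injective)) ks) target≡)

        completed-if-quiet : ¬ ∃ b-called-before → Completed (d + d)
        completed-if-quiet quiet = found d≤d+d ,
          certain-of-two (λ ()) (announced-a d≤d+d)
            (d + d , 0≤2d , ≤-refl , scout-at-y ,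
             reliable-announces (exec (d + d) 0≤2d) scout∉ scout-at-y)
          where
          0≤2d = ≤-trans 0≤d d≤d+d

          first : ∀ k s → 0# ≤ s → s ≤ d → Calls m k s → s ≡ d × side k ≡ side a
          first k s 0≤s s≤d ks with k Fin.≟ b
          ... | yes refl = ⊥-elim (quiet (s , 0≤s , s≤d , ks))
          ... | no k≢b   = call-by-other k s k≢b 0≤s ks

          scout-at-y : scout m (d + d) ≡ y
          scout-at-y = trans
            -- The call of `a` at time `d` leads: `b` has not called, and no other walker calls
            -- before `d`.
            (scout-arrives m (0≤d , trans a-announces (cong just target≡) , first))
            (sym target≡)

        -- If `a` were faulty, `b` and the scout would be reliable, and the scout would have to
        -- announce the target at time `s + s`; the log shows it silent, since that place is not the
        -- real target.
        completed-if-one-call : ∀ {s} → b-called-before s →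
                                (∀ t → b-called-before t → t ≡ s) → Completed (d + d)
        completed-if-one-call {s} (0≤s , s≤d , bs) only =
          certain-without-b d≤d+d λ τ consistent reliable →
            contradiction
              (trans (sym scout-silent)
                (reliable-announces (consistent (s + s) 0≤2s 2s≤2d) (reliable zero λ ())
                  (trans scout-there
                    (call⇒truthful τ consistent (reliable (suc b) (a≢b ∘ Fin.suc-injective))
                      0≤s (≤-trans s≤d d≤d+d) bs))))
              λ ()
          where
          0≤2s = ≤-trans 0≤s (x≤y+x 0≤s)
          2s≤2d = +-mono-≤ s≤d s≤d

          s≢d : s ≢ d
          s≢d refl = b-silent bs

          first : ∀ k t → 0# ≤ t → t ≤ s → Calls m k t → t ≡ s × side k ≡ side b
          first k t 0≤t t≤s kt with k Fin.≟ b
          ... | yes refl = only t (0≤t , ≤-trans t≤s s≤d , kt) , refl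
          ... | no k≢b   =
            -- Any other walker calls at time `d` only, which is later than `s`.
            let t≡d = proj₁ (call-by-other k t k≢b 0≤t kt) in
            contradiction (antisym s≤d (subst (_≤ s) t≡d t≤s)) s≢d

          scout-there : scout m (s + s) ≡ leg (side b) s
          scout-there = scout-arrives m (0≤s , bs , first)

          scout-silent : log zero (s + s) ≡ nothing
          scout-silent = MessagesAt.reliable-off-target (exec (s + s) 0≤2s) zero scout∉
            λ at → s≢d (leg-injective (side b) (trans (sym scout-there) (trans at (sym b-at-y))))

    completed : ∃ λ t → t ≤ d + d × Completed t
    completed with em {Calls m b d} | em {∃ b-called-before}
    ... | yes bd      | _ = d , d≤d+d , completed-if-both bd
    ... | no b-silent | no quiet = d + d , ≤-refl , completed-if-quiet b-silent quiet
    ... | no b-silent | yes (s , called) with em {∃ λ t → t ≢ s × b-called-before t}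
    ...   | yes (t , t≢s , again) = d , d≤d+d , completed-if-two-calls t≢s again called
    ...   | no ¬again = d + d , ≤-refl , completed-if-one-call b-silent called
      λ t again → decidable-stable em λ t≢s → ¬again (t , t≢s , again)

  -- At least one of the two walkers on the target's side is reliable; it takes the role of `a` in
  -- `completed`, with the two exchanged if necessary.
  search-on-side : ∀ {d} → 0# < d → ∀ σ {log} → Execution position σ log →
                   ∀ {a b} → a ≢ b → side a ≡ side b → target σ ≡ leg (side a) d →
                   ∃ λ t → t ≤ d + d × CompletedAt position t σ log
  search-on-side 0<d σ exec {a} a≢b a∥b target≡ with suc a ∈? faulty σ
  ... | no a∉  = completed σ 0<d exec a≢b a∉ a∥b target≡
  ... | yes a∈ = completed σ 0<d exec (a≢b ∘ sym) (other-reliable σ a∈ (a≢b ∘ Fin.suc-injective))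
    (sym a∥b) (trans target≡ (cong (λ c → leg c _) a∥b))

  search-time : ∀ d → 0# < d → SearchTimeAtMost algorithm d (2# * d)
  search-time d 0<d σ at log exec rewrite 2*x≡x+x d with at
  ... | inj₁ right = search-on-side 0<d σ exec
    {suc (suc zero)} {suc (suc (suc zero))} (λ ()) refl right
  ... | inj₂ left  = search-on-side 0<d σ exec {zero} {suc zero} (λ ()) refl left

proposition2 : ExcludedMiddle 0ℓ → (ℝ : CompleteOrderedField) →
    let open CompleteOrderedField ℝ using (2#)
        open Search ℝ
    in S[ 5 , 1 ]≤ 2# ·d
proposition2 em ℝ = SearchByFive.algorithm em ℝ , SearchByFive.search-time em ℝ
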